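{- Let $k\ge1$ and $l\ge7$ be integers satisfying $3+\widehat{c}_{k+l}\ge2\,\widehat{c}_k$. For $i=0,1,\dots,l$ put $C(k,l)_i=\mathcal{C}^{o}_{>1}(k+l)\setminus\{\widehat{c}_{k+i}\}$. If $2\,\mathbb{Z}^{o}_{\ge3}=2\,(\mathbb{Z}^{o}_{\ge3}\setminus C(k,l)_i)$ for every $i\in\{0,1,\dots,l\}$, then $2\,\mathbb{Z}^{o}_{\ge3}=2\,(\mathbb{Z}^{o}_{\ge3}\setminus\mathcal{C}^{o}_{>1}(k+l))$.
   Context: $\mathbb{Z}^{o}_{\ge3}$ is the set of all odd integers $\ge3$. $\widehat{c}_1<\widehat{c}_2<\cdots$ is the increasing enumeration of all odd composite positive integers ($\widehat{c}_1=9,\ \widehat{c}_2=15,\ \widehat{c}_3=21,\dots$), and $\mathcal{C}^{o}_{>1}(m)=\{\widehat{c}_1,\dots,\widehat{c}_m\}$ is the set of the first $m$ of them. For a non-empty set $S$ of integers, $2S=\{s+s': s,s'\in S\}$ (the sumset). -}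

module Defs where

open import Level using (0ℓ)
open import Data.Nat using (ℕ; zero; suc; _+_; _*_; _≤_; _<_; z≤n; s≤s)
open import Data.Nat.Divisibility using (_∣_; _∣?_; ∣m+n∣m⇒∣n; m∣m*n; ∣⇒≤; divides)
open import Data.Nat.Primality using (Composite; composite?; composite-≢; composite⇒nonZero)
open import Data.Nat.Properties
open import Data.Nat.Tactic.RingSolver using (solve-∀)
open import Data.Product using (∃; ∃-syntax; _×_; _,_; proj₁; proj₂)
open import Data.Sum using (inj₁; inj₂)
open import Relation.Binary.Definitions using (tri<; tri≈; tri>)
open import Relation.Binary.PropositionalEquality using (_≡_; refl; sym; cong; subst)
open import Relation.Nullary using (¬_; yes; no; contradiction; ¬?; _×-dec_)
open import Relation.Unary using (Pred; Decidable; _∈_; _∖_; ｛_｝)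

-- All the sets involved consist of positive integers, so they are taken as
-- predicates on ℕ.

Odd : ℕ → Set
Odd n = ¬ (2 ∣ n)

ℤᵒ≥3 : Pred ℕ 0ℓ
ℤᵒ≥3 n = Odd n × 3 ≤ n

OddComposite : Pred ℕ 0ℓ
OddComposite n = Odd n × Composite n

-- The sumset S + S; the two summands may coincide.
2·_ : Pred ℕ 0ℓ → Pred ℕ 0ℓ
(2· S) n = ∃[ s ] ∃[ s′ ] (s ∈ S × s′ ∈ S × n ≡ s + s′)

infix 8 2·_

LeastAbove : Pred ℕ 0ℓ → ℕ → Pred ℕ 0ℓ
LeastAbove P m n = m < n × P n × (∀ {j} → m < j → j < n → ¬ P j)

oddComposite? : Decidable OddComposite
oddComposite? n = ¬? (2 ∣? n) ×-dec composite? n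

-- The bound d is only there for termination of the upward search from suc m.
leastAbove : ∀ {P} → Decidable P → ∀ m d → P (suc (d + m)) → ∃ (LeastAbove P m)
leastAbove P? m zero    p = suc m , ≤-refl , p , λ m<j j<1+m _ → <⇒≱ m<j (≤-pred j<1+m)
leastAbove {P} P? m (suc d) p with P? (suc m)
... | yes q = suc m , ≤-refl , q , λ m<j j<1+m _ → <⇒≱ m<j (≤-pred j<1+m)
... | no ¬q with leastAbove P? (suc m) d (subst P (cong suc (sym (+-suc d m))) p)
...   | n , 1+m<n , r , least = n , <-trans (n<1+n m) 1+m<n , r , least′
  where
  least′ : ∀ {j} → m < j → j < n → ¬ P j
  least′ m<j j<n Pj with m≤n⇒m<n∨m≡n m<j
  ... | inj₁ 1+m<j = least 1+m<j j<n Pj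
  ... | inj₂ refl  = ¬q Pj

-- 3 (2 m + 3) is an odd composite above m.
oddComposite-above : ∀ m → OddComposite (suc (5 * m + 8 + m))
oddComposite-above m = odd , composite-≢ 3 3≢ (divides (2 * m + 3) (eq₃ m))
  where
  eq₂ : ∀ m → suc (5 * m + 8 + m) ≡ 2 * (3 * m + 4) + 1
  eq₂ = solve-∀
  eq₃ : ∀ m → suc (5 * m + 8 + m) ≡ (2 * m + 3) * 3
  eq₃ = solve-∀
  odd : Odd (suc (5 * m + 8 + m))
  odd 2∣ with ∣⇒≤ (∣m+n∣m⇒∣n (subst (2 ∣_) (eq₂ m) 2∣) (m∣m*n (3 * m + 4)))
  ... | s≤s ()
  3≢ : ¬ (3 ≡ suc (5 * m + 8 + m))
  3≢ e = <⇒≢ (s≤s (≤-trans (s≤s (s≤s (s≤s z≤n)))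
                    (≤-trans (m≤n+m 8 (5 * m)) (m≤m+n (5 * m + 8) m)))) e

-- Opaque because normalising this search for a variable m is very slow.
opaque
  nextOddComposite : ∀ m → ∃ (LeastAbove OddComposite m)
  nextOddComposite m = leastAbove oddComposite? m (5 * m + 8) (oddComposite-above m)

-- ĉ m is the m-th odd composite for m ≥ 1; ĉ 0 = 0 only starts the recursion.
ĉ : ℕ → ℕ
ĉ zero    = 0
ĉ (suc m) = proj₁ (nextOddComposite (ĉ m))

-- The next four facts confirm that ĉ 1 < ĉ 2 < … enumerates the odd composites.

opaque
  unfolding nextOddComposite

  ĉ-values : ĉ 1 ≡ 9 × ĉ 2 ≡ 15 × ĉ 3 ≡ 21
  ĉ-values = refl , refl , refl

ĉ-oddComposite : ∀ m → OddComposite (ĉ (suc m))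
ĉ-oddComposite m = proj₁ (proj₂ (proj₂ (nextOddComposite (ĉ m))))

ĉ-increasing : ∀ m → ĉ m < ĉ (suc m)
ĉ-increasing m = proj₁ (proj₂ (nextOddComposite (ĉ m)))

ĉ-surjective : ∀ {n} → OddComposite n → ∃[ m ] n ≡ ĉ (suc m)
ĉ-surjective {n} oc = go n (m≤ĉ (suc n))
  where
  m≤ĉ : ∀ m → m ≤ ĉ m
  m≤ĉ zero    = z≤n
  m≤ĉ (suc m) = ≤-trans (s≤s (m≤ĉ m)) (ĉ-increasing m)
  go : ∀ m → n < ĉ (suc m) → ∃[ m ] n ≡ ĉ (suc m)
  go m n<ĉ with <-cmp n (ĉ m)
  go m       n<ĉ | tri> _ _ ĉ<n =
    contradiction oc (proj₂ (proj₂ (proj₂ (nextOddComposite (ĉ m)))) ĉ<n n<ĉ)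
  go zero    n<ĉ | tri≈ _ refl _ with composite⇒nonZero (proj₂ oc)
  ... | ()
  go (suc m) n<ĉ | tri≈ _ n≡ _ = m , n≡
  go (suc m) n<ĉ | tri< n< _ _ = go m n<

𝒞ᵒ>1 : ℕ → Pred ℕ 0ℓ
𝒞ᵒ>1 m n = ∃[ j ] (1 ≤ j × j ≤ m × n ≡ ĉ j)

C : (k l i : ℕ) → Pred ℕ 0ℓ
C k l i = 𝒞ᵒ>1 (k + l) ∖ ｛ ĉ (k + i) ｝

{-# OPTIONS --safe #-}

-- Let N = ĉ (k + l) and let n be a sum of two odd integers ≥ 3.  If n > 3 + N
-- then n = 3 + (n − 3) is a decomposition avoiding all of 𝒞ᵒ>1 (k + l), and if
-- n < 3 + N then the hypothesis for i = l gives one, its summands being < N.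
-- There remains n = 3 + N.  One of n − 9, n − 25, n − 35 is a multiple of 3, so
-- n = z + w with z ≠ w odd composites.  The larger one, say z, is ≥ n / 2 ≥ ĉ k,
-- so z = ĉ (k + i) for some i ≤ l.  A decomposition of n avoiding C k l i cannot
-- use z, since the other summand w lies in C k l i; hence it avoids
-- 𝒞ᵒ>1 (k + l).

module Submission where

open import Defs
open import Data.Nat using (ℕ; zero; suc; _+_; _*_; _∸_; _≤_; _<_; _≥_; z≤n; s≤s)
open import Data.Nat.Divisibility
  using (_∣_; _∣?_; ∣-refl; ∣m∣n⇒∣m+n; ∣m+n∣m⇒∣n; _∣0; divides-refl)
open import Data.Nat.Primality using (composite-≢; prime?; prime⇒¬composite)
open import Data.Nat.Properties
open import Data.Product using (∃-syntax; _×_; _,_; proj₁; proj₂)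
open import Data.Sum using (_⊎_; inj₁; inj₂)
open import Function using (_∘_)
open import Relation.Binary.Definitions using (tri<; tri≈; tri>)
open import Relation.Binary.PropositionalEquality
  using (_≡_; _≢_; refl; sym; trans; cong; subst)
open import Relation.Nullary using (yes; no; contradiction)
open import Relation.Nullary.Decidable using (from-yes; from-no)
open import Relation.Unary using (_≐_; _∖_; _∈_; _∉_)

odd⇒2∣suc : ∀ n → Odd n → 2 ∣ suc n
odd⇒2∣suc zero          odd = contradiction (2 ∣0) odd
odd⇒2∣suc (suc zero)    odd = ∣-refl
odd⇒2∣suc (suc (suc n)) odd =
  ∣m∣n⇒∣m+n ∣-refl (odd⇒2∣suc n (odd ∘ ∣m∣n⇒∣m+n ∣-refl))

odd+odd : ∀ m n → Odd m → Odd n → 2 ∣ m + n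
-- The even number `suc m + suc n` equals `2 + (m + n)`, and the 2 cancels.
odd+odd m n odd-m odd-n = ∣m+n∣m⇒∣n
  (subst (2 ∣_) (cong suc (+-suc m n)) (∣m∣n⇒∣m+n (odd⇒2∣suc m odd-m) (odd⇒2∣suc n odd-n)))
  ∣-refl

even-odd : ∀ {m n} → 2 ∣ m + n → Odd m → Odd n
even-odd {m} {n} 2∣m+n odd-m 2∣n = odd-m (∣m+n∣m⇒∣n (subst (2 ∣_) (+-comm m n) 2∣m+n) 2∣n)

3∣n⊎3∣1+n⊎3∣2+n : ∀ n → 3 ∣ n ⊎ 3 ∣ 1 + n ⊎ 3 ∣ 2 + n
3∣n⊎3∣1+n⊎3∣2+n zero = inj₁ (3 ∣0)
3∣n⊎3∣1+n⊎3∣2+n (suc n) with 3∣n⊎3∣1+n⊎3∣2+n n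
... | inj₁ 3∣n          = inj₂ (inj₂ (∣m∣n⇒∣m+n ∣-refl 3∣n))
... | inj₂ (inj₁ 3∣1+n) = inj₁ 3∣1+n
... | inj₂ (inj₂ 3∣2+n) = inj₂ (inj₁ 3∣2+n)

ĉ-mono-≤ : ∀ {m n} → m ≤ n → ĉ m ≤ ĉ n
ĉ-mono-≤ {n = zero} z≤n = ≤-refl
ĉ-mono-≤ {n = suc n} m≤1+n with m≤n⇒m<n∨m≡n m≤1+n
... | inj₁ (s≤s m≤n) = ≤-trans (ĉ-mono-≤ m≤n) (<⇒≤ (ĉ-increasing n))
... | inj₂ refl      = ≤-refl

ĉ-cancel-≤ : ∀ {m n} → ĉ m ≤ ĉ n → m ≤ n
ĉ-cancel-≤ {m} {n} ĉm≤ĉn with m ≤? n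
... | yes m≤n = m≤n
... | no  m≰n = contradiction ĉm≤ĉn
  (<⇒≱ (<-≤-trans (ĉ-increasing n) (ĉ-mono-≤ (≰⇒> m≰n))))

opaque
  unfolding nextOddComposite

  -- With `k ≥ 1` and `l ≥ 7` this yields `39 ≤ ĉ (k + l)`, so the critical sum is at least 42, as
  -- `compositeSplit` requires.
  ĉ-8 : ĉ 8 ≡ 39
  ĉ-8 = refl

ĉ-composite : ∀ {j} → 1 ≤ j → OddComposite (ĉ j)
ĉ-composite {suc j} _ = ĉ-oddComposite j

𝒞⇒composite : ∀ {m n} → n ∈ 𝒞ᵒ>1 m → OddComposite n
𝒞⇒composite (j , 1≤j , _ , refl) = ĉ-composite 1≤j

𝒞⇒≤ĉ : ∀ {m n} → n ∈ 𝒞ᵒ>1 m → n ≤ ĉ m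
𝒞⇒≤ĉ (j , _ , j≤m , refl) = ĉ-mono-≤ j≤m

composite⇒𝒞 : ∀ {m n} → OddComposite n → n ≤ ĉ m → n ∈ 𝒞ᵒ>1 m
composite⇒𝒞 oc n≤ĉm with ĉ-surjective oc
... | j , refl = suc j , s≤s z≤n , ĉ-cancel-≤ n≤ĉm , refl

∉C⇒∉𝒞 : ∀ {k l i n} → n ∉ C k l i → n ≢ ĉ (k + i) → n ∉ 𝒞ᵒ>1 (k + l)
∉C⇒∉𝒞 n∉C n≢ĉ n∈𝒞 = n∉C (n∈𝒞 , n≢ĉ ∘ sym)

ĉ-index : ∀ {k l z} → OddComposite z → ĉ k ≤ z → z ≤ ĉ (k + l) →
  ∃[ i ] i ≤ l × z ≡ ĉ (k + i)
ĉ-index {k} {l} oc ĉk≤z z≤ĉ with ĉ-surjective oc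
-- The truncated subtraction is exact: `ĉ k ≤ ĉ (suc j)` forces `k ≤ suc j`.
... | j , refl = suc j ∸ k
  , ≤-trans (∸-monoˡ-≤ k (ĉ-cancel-≤ z≤ĉ)) (≤-reflexive (m+n∸m≡n k l))
  , cong ĉ (sym (m+[n∸m]≡n (ĉ-cancel-≤ {k} ĉk≤z)))

-- For the sum `3 + N`, the lower bounds keep both summands at most `N`; `x ≢ y` ensures that
-- sparing one of them leaves the other excluded.
CompositeSplit : ℕ → Set
CompositeSplit n =
  ∃[ x ] ∃[ y ] OddComposite x × OddComposite y × 3 ≤ x × 3 ≤ y × x ≢ y × n ≡ x + y

-- The odd composites 9, 25 and 35 represent the residues 0, 1 and 2 modulo 3, so subtracting a
-- suitable one leaves a multiple of 3. Starting at 42 = 35 + 7 makes this remainder exceed 3, hence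
-- composite.
compositeSplit : ∀ r → 2 ∣ 42 + r → CompositeSplit (42 + r)
compositeSplit r 2∣n with 3∣n⊎3∣1+n⊎3∣2+n r
... | inj₁ 3∣r =
  9 , 33 + r , from-yes (oddComposite? 9)
  , (even-odd {9} 2∣n (from-no (2 ∣? 9)) , composite-≢ 3 (λ ()) (∣m∣n⇒∣m+n (divides-refl 11) 3∣r))
  , m≤m+n 3 6 , m≤m+n 3 (30 + r) , (λ ()) , refl
... | inj₂ (inj₁ 3∣1+r) =
  -- The summands differ because 3 divides the second but not 35; likewise for 25 below.
  35 , 7 + r , from-yes (oddComposite? 35)
  , (even-odd {35} 2∣n (from-no (2 ∣? 35)) , composite-≢ 3 (λ ()) 3∣y)
  , m≤m+n 3 32 , m≤m+n 3 (4 + r) , (λ x≡y → from-no (3 ∣? 35) (subst (3 ∣_) (sym x≡y) 3∣y)) , refl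
  where
  3∣y : 3 ∣ 7 + r
  3∣y = ∣m∣n⇒∣m+n (divides-refl 2) 3∣1+r
... | inj₂ (inj₂ 3∣2+r) =
  25 , 17 + r , from-yes (oddComposite? 25)
  , (even-odd {25} 2∣n (from-no (2 ∣? 25)) , composite-≢ 3 (λ ()) 3∣y)
  , m≤m+n 3 22 , m≤m+n 3 (14 + r) , (λ x≡y → from-no (3 ∣? 25) (subst (3 ∣_) (sym x≡y) 3∣y)) , refl
  where
  3∣y : 3 ∣ 17 + r
  3∣y = ∣m∣n⇒∣m+n (divides-refl 5) 3∣2+r

half-≤ : ∀ {a z w} → 2 * a ≤ z + w → w ≤ z → a ≤ z
half-≤ {a} {z} {w} 2a≤z+w w≤z = *-cancelˡ-≤ 2
  (≤-trans 2a≤z+w (+-monoʳ-≤ z (≤-trans w≤z (m≤m+n z 0))))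

summand-≤ : ∀ {N z w} → 3 + N ≡ z + w → 3 ≤ w → z ≤ N
summand-≤ {N} {z} {w} e 3≤w = +-cancelˡ-≤ 3 z N
  (≤-trans (+-monoˡ-≤ z 3≤w) (≤-reflexive (trans (+-comm w z) (sym e))))

2·-mono : ∀ {S T} → (∀ {s} → s ∈ S → s ∈ T) → ∀ {n} → n ∈ 2· S → n ∈ 2· T
2·-mono S⊆T (s , s′ , s∈S , s′∈S , n≡) = s , s′ , S⊆T s∈S , S⊆T s′∈S , n≡

avoid-large : ∀ {m n} → 3 ≤ ĉ m → 2 ∣ n → 3 + ĉ m < n → n ∈ 2· (ℤᵒ≥3 ∖ 𝒞ᵒ>1 m)
avoid-large {m} {n} 3≤N 2∣n 3+N<n =
  3 , n ∸ 3
  -- The summand 3 is prime, hence never excluded.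
  , ((odd-3 , ≤-refl) , prime⇒¬composite (from-yes (prime? 3)) ∘ proj₂ ∘ 𝒞⇒composite)
  , ((odd-t , ≤-trans 3≤N (<⇒≤ N<t)) , λ t∈𝒞 → <⇒≱ N<t (𝒞⇒≤ĉ t∈𝒞))
  , n≡
  where
  n≡ : n ≡ 3 + (n ∸ 3)
  n≡ = sym (m+[n∸m]≡n (≤-trans (m≤m+n 3 (ĉ m)) (<⇒≤ 3+N<n)))
  odd-3 : Odd 3
  odd-3 = from-no (2 ∣? 3)
  odd-t : Odd (n ∸ 3)
  odd-t = even-odd {3} (subst (2 ∣_) n≡ 2∣n) odd-3
  N<t : ĉ m < n ∸ 3
  N<t = m+n≤o⇒m≤o∸n (suc (ĉ m)) (subst (_≤ n) (cong suc (+-comm 3 (ĉ m))) 3+N<n)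

theorem3p12 : (k l : ℕ) → k ≥ 1 → l ≥ 7 →
    3 + ĉ (k + l) ≥ 2 * ĉ k →
    (∀ i → i ≤ l → 2· ℤᵒ≥3 ≐ 2· (ℤᵒ≥3 ∖ C k l i)) →
    2· ℤᵒ≥3 ≐ 2· (ℤᵒ≥3 ∖ 𝒞ᵒ>1 (k + l))
theorem3p12 k l k≥1 l≥7 3+N≥2ĉk hyp = avoid , 2·-mono proj₁
  where
  N : ℕ
  N = ĉ (k + l)

  N≥39 : 39 ≤ N
  N≥39 = subst (_≤ N) ĉ-8 (ĉ-mono-≤ (+-mono-≤ k≥1 l≥7))

  avoid-small : ∀ {n} → n ∈ 2· ℤᵒ≥3 → n < 3 + N → n ∈ 2· (ℤᵒ≥3 ∖ 𝒞ᵒ>1 (k + l))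
  -- For `i = l` only `N` is spared, and a summand `N` beside one that is at least 3 would give
  -- `3 + N ≤ n`.
  avoid-small n∈ n<3+N with proj₁ (hyp l ≤-refl) n∈
  ... | s , s′ , ((odd-s , 3≤s) , s∉C) , ((odd-s′ , 3≤s′) , s′∉C) , refl =
    s , s′
    , ((odd-s , 3≤s) , ∉C⇒∉𝒞 {k} {l} {l} s∉C λ { refl →
        <⇒≱ n<3+N (≤-trans (+-monoˡ-≤ N 3≤s′) (≤-reflexive (+-comm s′ N))) })
    , ((odd-s′ , 3≤s′) , ∉C⇒∉𝒞 {k} {l} {l} s′∉C λ { refl → <⇒≱ n<3+N (+-monoˡ-≤ N 3≤s) })
    , refl

  avoid-split : ∀ {n z w} → n ∈ 2· ℤᵒ≥3 → n ≡ z + w → OddComposite z → OddComposite w →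
    z ≢ w → ĉ k ≤ z → z ≤ N → w ≤ N → n ∈ 2· (ℤᵒ≥3 ∖ 𝒞ᵒ>1 (k + l))
  avoid-split {n} {z} {w} n∈ n≡z+w oc-z oc-w z≢w ĉk≤z z≤N w≤N
    with ĉ-index {k} {l} oc-z ĉk≤z z≤N
  ... | i , i≤l , refl with proj₁ (hyp i i≤l) n∈
  ...   | s , s′ , (s∈ , s∉C) , (s′∈ , s′∉C) , n≡s+s′ =
    s , s′
    -- If `s` were `z`, cancellation would turn `s′` into `w`, which is still excluded.
    , (s∈ , ∉C⇒∉𝒞 {k} {l} {i} s∉C λ { refl →
        s′∉C (w∈C s′ (+-cancelˡ-≡ z s′ w (trans (sym n≡s+s′) n≡z+w))) })
    , (s′∈ , ∉C⇒∉𝒞 {k} {l} {i} s′∉C λ { refl →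
        s∉C (w∈C s (+-cancelˡ-≡ z s w (trans (+-comm z s) (trans (sym n≡s+s′) n≡z+w)))) })
    , n≡s+s′
    where
    w∈C : ∀ t → t ≡ w → t ∈ C k l i
    w∈C t refl = composite⇒𝒞 oc-w w≤N , z≢w

  avoid-critical : 3 + N ∈ 2· ℤᵒ≥3 → CompositeSplit (3 + N) →
    3 + N ∈ 2· (ℤᵒ≥3 ∖ 𝒞ᵒ>1 (k + l))
  avoid-critical n∈ (x , y , oc-x , oc-y , 3≤x , 3≤y , x≢y , n≡x+y)
    with ≤-total y x
  -- The larger summand goes first: only it is sure to reach `ĉ k`, and so to be the element spared
  -- for some `i ≤ l`.
  ... | inj₁ y≤x = avoid-split n∈ n≡x+y oc-x oc-y x≢y
    (half-≤ {ĉ k} (subst (2 * ĉ k ≤_) n≡x+y 3+N≥2ĉk) y≤x)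
    (summand-≤ n≡x+y 3≤y) (summand-≤ (trans n≡x+y (+-comm x y)) 3≤x)
  ... | inj₂ x≤y = avoid-split n∈ n≡y+x oc-y oc-x (x≢y ∘ sym)
    (half-≤ {ĉ k} (subst (2 * ĉ k ≤_) n≡y+x 3+N≥2ĉk) x≤y)
    (summand-≤ n≡y+x 3≤x) (summand-≤ n≡x+y 3≤y)
    where
    n≡y+x : 3 + N ≡ y + x
    n≡y+x = trans n≡x+y (+-comm x y)

  avoid : ∀ {n} → n ∈ 2· ℤᵒ≥3 → n ∈ 2· (ℤᵒ≥3 ∖ 𝒞ᵒ>1 (k + l))
  avoid {n} n∈@(a , b , (odd-a , _) , (odd-b , _) , n≡a+b) with <-cmp n (3 + N)
  ... | tri< n<3+N _ _ = avoid-small n∈ n<3+N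
  ... | tri> _ _ 3+N<n = avoid-large {k + l} (≤-trans (m≤m+n 3 36) N≥39) 2∣n 3+N<n
    where
    2∣n : 2 ∣ n
    2∣n = subst (2 ∣_) (sym n≡a+b) (odd+odd a b odd-a odd-b)
  ... | tri≈ _ refl _ = avoid-critical n∈
    (subst CompositeSplit 42+r≡n
      (compositeSplit (N ∸ 39) (subst (2 ∣_) (trans (sym n≡a+b) (sym 42+r≡n)) (odd+odd a b odd-a odd-b))))
    where
    42+r≡n : 42 + (N ∸ 39) ≡ 3 + N
    42+r≡n = cong (3 +_) (m+[n∸m]≡n N≥39)
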